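{- For $n\ge 46$ let $\mathbb{M}_n=(V,\mathcal{C})$ be the rank-$2$ uniform matroid on $n$ elements, i.e. $|V|=n$ and $\mathcal{C}=\{C\subseteq V:|C|=3\}$, and let $|\mathbb{M}_n|_C$ be the minimum cardinality of a subfamily $\mathcal{D}\subseteq\mathcal{C}$ with $\Phi_{\mathcal{D}}=\Phi_{\mathcal{C}}$. Then $|\mathbb{M}_n|_C=\frac{n^2}{5}+O(n)$, i.e., there is an absolute constant $K$ such that $\left||\mathbb{M}_n|_C-\frac{n^2}{5}\right|\le Kn$ for all $n\ge 46$.
   Context: Boolean functions on $V$ are viewed as functions of subsets; the clause $B\to v$ ($v\notin B$) has true sets the $T$ with $B\not\subseteq T$ or $B\cup\{v\}\subseteq T$; $\Phi_{\mathcal{H}}=\bigwedge_{H\in\mathcal{H}}\bigwedge_{v\in H}((H\setminus\{v\})\to v)$, compared as Boolean functions. -}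

module Defs where

open import Data.Nat using (ℕ; _≤_; _+_; _*_)
open import Data.Fin using (Fin)
open import Data.Fin.Subset using (Subset; _∈_; _⊆_; _∪_; ⁅_⁆; _-_; ∣_∣)
open import Data.List using (List; length)
import Data.List.Membership.Propositional as LM
open import Data.List.Relation.Unary.All using (All)
open import Data.List.Relation.Unary.Unique.Propositional using (Unique)
open import Data.Product using (_×_)
open import Data.Sum using (_⊎_)
open import Relation.Nullary using (¬_)
open import Function.Bundles using (_⇔_)

-- Boolean functions on V = Fin n are predicates on subsets T ⊆ V.
-- The clause B → v : true sets are T with B ⊈ T or B ∪ {v} ⊆ T.
Clause : ∀ {n} → Subset n → Fin n → Subset n → Set
Clause B v T = (¬ (B ⊆ T)) ⊎ ((B ∪ ⁅ v ⁆) ⊆ T)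

Φ : ∀ {n} → (Subset n → Set) → Subset n → Set
Φ ℋ T = ∀ H → ℋ H → ∀ v → v ∈ H → Clause (H - v) v T

Circuit : ∀ {n} → Subset n → Set
Circuit C = ∣ C ∣ ≡ 3
  where open import Relation.Binary.PropositionalEquality using (_≡_)

member : ∀ {n} → List (Subset n) → Subset n → Set
member D H = H LM.∈ D

SameFun : ∀ {n} → (Subset n → Set) → (Subset n → Set) → Set
SameFun {n} f g = (T : Subset n) → f T ⇔ g T

IsCover : ∀ n → List (Subset n) → Set
IsCover n D = Unique D × All Circuit D × SameFun (Φ (member D)) (Φ Circuit)

IsMinCoverSize : ℕ → ℕ → Set
IsMinCoverSize n m =
  (Σ' (List (Subset n)) λ D → IsCover n D × length D ≡ m)
  × (∀ D → IsCover n D → m ≤ length D)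
  where
  open import Relation.Binary.PropositionalEquality using (_≡_)
  open import Data.Product using () renaming (Σ to Σ')

{-# OPTIONS --safe #-}
-- A family D of triples is a cover iff every set T with 2 ≤ |T| < n is met by some triple of D
-- in exactly two points.
--
-- Lower bound: T = {u, v} shows that every pair lies in a triple of D, and T = H shows that every
-- H ∈ D has a pair lying in a second triple.  Give each pair charge 2 if it lies in one triple and
-- charge 1 per triple otherwise: a pair receives at least 2, a triple pays at most 2 + 2 + 1.
--
-- Upper bound: on the cyclic group ℤ/n, with s = n / 20, take all translates of the triples
-- {0, p, p + x} and {0, p, p + x′} for 1 ≤ p ≤ 2 s.  Each p accounts for the five differences p, x,
-- p + x, x′, p + x′, and, as in Skolem sequences, nesting the pairs (x, x + p) around common
-- centres, separately for odd and even p, exhausts all but O(1) of the differences up to n / 2.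
-- Nesting also makes x′ - x depend only on the parity of p, so the closure of any pair contains a
-- pair at one of O(1) distances d; for those all translates of {0, d, d + 1} are added, after
-- which the closure contains two, and hence all, consecutive points.
module Submission where

open import Defs
open import Data.Bool using (if_then_else_)
import Data.Bool.Properties as Bool
open import Data.Fin using (Fin; zero; suc; toℕ)
open import Data.Fin.Properties as Fin using (all?; any?; toℕ<n; toℕ-injective; toℕ-fromℕ<)
open import Data.Fin.Subset
  using (Subset; Nonempty; inside; outside; ⊤; ⁅_⁆; _∈_; _∉_; _⊆_; _∪_; _-_; ∣_∣)
open import Data.Fin.Subset.Properties
open import Data.List as List
  using (List; []; _∷_; length; _++_; map; applyUpTo; upTo; cartesianProductWith; deduplicate)
open import Data.List.Membership.Propositional using () renaming (_∈_ to _∈ˡ_)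
open import Data.List.Membership.Propositional.Properties
open import Data.List.Properties
  using (length-map; length-++; length-applyUpTo; length-upTo; length-deduplicate)
open import Data.List.Relation.Unary.All as All using (All; []; _∷_)
import Data.List.Relation.Unary.All.Properties as All
open import Data.List.Relation.Unary.Any as Any using (here; there)
open import Data.List.Relation.Unary.Any.Properties using (lookup-index)
import Data.List.Relation.Unary.Unique.DecPropositional as DecUnique
open import Data.List.Relation.Unary.Unique.DecPropositional.Properties using (deduplicate-!)
open import Data.Nat hiding (∣_-_∣)
open import Data.Nat.Divisibility using (_∣_; ∣m+n∣m⇒∣n; ∣⇒≤; n∣m*n)
open import Data.Nat.DivMod
  using (_mod_; m≡m%n+[m/n]*n; m%n<n; m%n%n≡m%n; [m+kn]%n≡m%n; m<n⇒m%n≡m; m/n*n≤m)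
open import Data.Nat.Properties
open import Data.Nat.Tactic.RingSolver using (solve-∀)
open import Data.Product using (Σ; ∃; ∃₂; _×_; _,_; proj₁; proj₂)
open import Data.Sum using (_⊎_; inj₁; inj₂)
open import Data.Vec as Vec using ([]; _∷_; lookup)
open import Data.Vec.Properties using ([]=⇒lookup; lookup⇒[]=; ≡-dec)
open import Function using (_∘_; _⇔_; mk⇔)
open import Function.Bundles using (Equivalence)
open import Relation.Binary.Definitions using (DecidableEquality; tri<; tri≈; tri>)
open import Relation.Binary.PropositionalEquality
open import Relation.Nullary
  using (Dec; yes; no; contradiction; ¬?; _×-dec_; _→-dec_; _⊎-dec_)
open import Relation.Nullary.Decidable using (map′; decidable-stable)
open import Relation.Unary using (Decidable)
open import Algebra.Properties.Semiring.Sum +-*-semiring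
  using (sum; sum-syntax; sum-cong-≗; ∑-distrib-+; ∑-comm; *-distribˡ-sum; *-distribʳ-sum)

private variable n : ℕ

-- Cardinalities of finite subsets, pairs and triples.

x∉p-x : (p : Subset n) (x : Fin n) → x ∉ p - x
x∉p-x (outside ∷ p) zero    ()
x∉p-x (inside  ∷ p) zero    ()
x∉p-x (s       ∷ p) (suc x) x∈ = x∉p-x p x (drop-there x∈)

∈-⇒∈×≢ : (p : Subset n) {x y : Fin n} → x ∈ p - y → x ∈ p × x ≢ y
∈-⇒∈×≢ p {y = y} x∈ = p─q⊆p p ⁅ y ⁆ x∈ , λ { refl → x∉p-x p y x∈ }

∣p-x∣ : (p : Subset n) {x : Fin n} → x ∈ p → suc ∣ p - x ∣ ≡ ∣ p ∣
∣p-x∣ (inside  ∷ p) Vec.here         = cong (suc ∘ ∣_∣) (p─⊥≡p p)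
∣p-x∣ (outside ∷ p) (Vec.there x∈)   = ∣p-x∣ p x∈
∣p-x∣ (inside  ∷ p) (Vec.there x∈)   = cong suc (∣p-x∣ p x∈)

∣⁅x⁆∪p∣ : (p : Subset n) {x : Fin n} → x ∉ p → ∣ ⁅ x ⁆ ∪ p ∣ ≡ suc ∣ p ∣
∣⁅x⁆∪p∣ (inside  ∷ p) {zero}  x∉ = contradiction Vec.here x∉
∣⁅x⁆∪p∣ (outside ∷ p) {zero}  x∉ = cong (suc ∘ ∣_∣) (∪-identityˡ p)
∣⁅x⁆∪p∣ (outside ∷ p) {suc x} x∉ = ∣⁅x⁆∪p∣ p (x∉ ∘ Vec.there)
∣⁅x⁆∪p∣ (inside  ∷ p) {suc x} x∉ = cong suc (∣⁅x⁆∪p∣ p (x∉ ∘ Vec.there))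

∣p∣>0⇒Nonempty : (p : Subset n) → 0 < ∣ p ∣ → Nonempty p
∣p∣>0⇒Nonempty {n} p 0<∣p∣ with nonempty? p
... | yes ne = ne
... | no empty = contradiction (trans (cong ∣_∣ (Empty-unique empty)) (∣⊥∣≡0 n)) (m<n⇒n≢0 0<∣p∣)

∣p∣<n⇒∃∉ : (p : Subset n) → ∣ p ∣ < n → ∃ λ z → z ∉ p
∣p∣<n⇒∃∉ {n} p ∣p∣<n with any? (λ z → ¬? (z ∈? p))
... | yes z = z
... | no ¬∃ = contradiction (subst (_≤ ∣ p ∣) (∣⊤∣≡n n) (p⊆q⇒∣p∣≤∣q∣ ⊤⊆p)) (<⇒≱ ∣p∣<n)
  where
  ⊤⊆p : ⊤ ⊆ p
  ⊤⊆p {x} _ with x ∈? p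
  ... | yes x∈p = x∈p
  ... | no  x∉p = contradiction (x , x∉p) ¬∃

twoElements : {p : Subset n} → Circuit p → ∀ {v} → v ∈ p →
              ∃₂ λ a b → a ≢ b × a ∈ p - v × b ∈ p - v
twoElements {p = p} ∣p∣≡3 {v} v∈p
  with eq ← suc-injective (trans (∣p-x∣ p v∈p) ∣p∣≡3)
  with a , a∈ ← ∣p∣>0⇒Nonempty (p - v) (≤-trans (s≤s z≤n) (≤-reflexive (sym eq)))
  with b , b∈ ← ∣p∣>0⇒Nonempty (p - v - a)
                  (≤-reflexive (sym (suc-injective (trans (∣p-x∣ (p - v) a∈) eq))))
  with b∈p-v , b≢a ← ∈-⇒∈×≢ (p - v) b∈
  = a , b , ≢-sym b≢a , a∈ , b∈p-v

triple : (a b c : Fin n) → Subset n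
triple a b c = ⁅ a ⁆ ∪ (⁅ b ⁆ ∪ ⁅ c ⁆)

module _ {a b c : Fin n} where
  ∈triple⁻ : ∀ {x} → x ∈ triple a b c → x ≡ a ⊎ x ≡ b ⊎ x ≡ c
  ∈triple⁻ x∈ with x∈p∪q⁻ ⁅ a ⁆ (⁅ b ⁆ ∪ ⁅ c ⁆) x∈
  ... | inj₁ x∈a = inj₁ (x∈⁅y⁆⇒x≡y a x∈a)
  ... | inj₂ x∈bc with x∈p∪q⁻ ⁅ b ⁆ ⁅ c ⁆ x∈bc
  ...   | inj₁ x∈b = inj₂ (inj₁ (x∈⁅y⁆⇒x≡y b x∈b))
  ...   | inj₂ x∈c = inj₂ (inj₂ (x∈⁅y⁆⇒x≡y c x∈c))

  triple-fst : a ∈ triple a b c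
  triple-fst = x∈p∪q⁺ (inj₁ (x∈⁅x⁆ a))

  triple-snd : b ∈ triple a b c
  triple-snd = x∈p∪q⁺ (inj₂ (x∈p∪q⁺ (inj₁ (x∈⁅x⁆ b))))

  triple-thd : c ∈ triple a b c
  triple-thd = x∈p∪q⁺ (inj₂ (x∈p∪q⁺ (inj₂ (x∈⁅x⁆ c))))

∈pair⁻ : {a b x : Fin n} → x ∈ ⁅ a ⁆ ∪ ⁅ b ⁆ → x ≡ a ⊎ x ≡ b
∈pair⁻ {a = a} {b} x∈ with x∈p∪q⁻ ⁅ a ⁆ ⁅ b ⁆ x∈
... | inj₁ x∈a = inj₁ (x∈⁅y⁆⇒x≡y a x∈a)
... | inj₂ x∈b = inj₂ (x∈⁅y⁆⇒x≡y b x∈b)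

∣pair∣≡2 : {a b : Fin n} → a ≢ b → ∣ ⁅ a ⁆ ∪ ⁅ b ⁆ ∣ ≡ 2
∣pair∣≡2 {b = b} a≢b = trans (∣⁅x⁆∪p∣ ⁅ b ⁆ (x≢y⇒x∉⁅y⁆ a≢b)) (cong suc (∣⁅x⁆∣≡1 b))

triple-circuit : {a b c : Fin n} → a ≢ b → a ≢ c → b ≢ c → Circuit (triple a b c)
triple-circuit {a = a} {b} {c} a≢b a≢c b≢c = trans (∣⁅x⁆∪p∣ (⁅ b ⁆ ∪ ⁅ c ⁆) a∉) (cong suc (∣pair∣≡2 b≢c))
  where
  a∉ : a ∉ ⁅ b ⁆ ∪ ⁅ c ⁆
  a∉ a∈ with ∈pair⁻ a∈
  ... | inj₁ a≡b = a≢b a≡b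
  ... | inj₂ a≡c = a≢c a≡c

-- Clauses read as implications.

fires : {B T : Subset n} {v : Fin n} → B ⊆ T → v ∈ T → B ∪ ⁅ v ⁆ ⊆ T
fires {B = B} {v = v} B⊆T v∈T x∈ with x∈p∪q⁻ B ⁅ v ⁆ x∈
... | inj₁ x∈B = B⊆T x∈B
... | inj₂ x∈v rewrite x∈⁅y⁆⇒x≡y v x∈v = v∈T

clause-elim : {B T : Subset n} {v : Fin n} → Clause B v T → B ⊆ T → v ∈ T
clause-elim         (inj₁ B⊈T) B⊆T = contradiction (λ {x} → B⊆T {x}) B⊈T
clause-elim {B = B} {v = v} (inj₂ Bv⊆T) _ = Bv⊆T (q⊆p∪q B ⁅ v ⁆ (x∈⁅x⁆ v))

clause-intro : {B T : Subset n} {v : Fin n} → (B ⊆ T → v ∈ T) → Clause B v T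
clause-intro {B = B} {T} f with B ⊆? T
... | yes B⊆T = inj₂ (fires B⊆T (f B⊆T))
... | no  B⊈T = inj₁ B⊈T

-- Finite sums and indicator functions.

∑-mono : {f g : Fin n → ℕ} → (∀ i → f i ≤ g i) → sum f ≤ sum g
∑-mono {zero}  f≤g = z≤n
∑-mono {suc n} f≤g = +-mono-≤ (f≤g zero) (∑-mono (f≤g ∘ suc))

∑-const : ∀ n c → ∑[ i < n ] c ≡ n * c
∑-const zero    c = refl
∑-const (suc n) c = cong (c +_) (∑-const n c)

∑∑-* : (f g : Fin n → ℕ) → ∑[ u < n ] ∑[ v < n ] (f u * g v) ≡ sum f * sum g
∑∑-* f g = trans (sum-cong-≗ (λ u → sym (*-distribˡ-sum (f u) g))) (sym (*-distribʳ-sum (sum g) f))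

χ : Subset n → Fin n → ℕ
χ p x = if lookup p x then 1 else 0

∑χ : (p : Subset n) → sum (χ p) ≡ ∣ p ∣
∑χ []            = refl
∑χ (inside  ∷ p) = cong suc (∑χ p)
∑χ (outside ∷ p) = ∑χ p

χ-∈ : {p : Subset n} {x : Fin n} → x ∈ p → χ p x ≡ 1
χ-∈ x∈p rewrite []=⇒lookup x∈p = refl

χ-∉ : {p : Subset n} {x : Fin n} → x ∉ p → χ p x ≡ 0
χ-∉ {p = p} {x} x∉p with lookup p x in eq
... | inside  = contradiction (lookup⇒[]= x p eq) x∉p
... | outside = refl

-- Kronecker delta, taken as the indicator of a singleton so that its sum is a cardinality.
δ : Fin n → Fin n → ℕ
δ i = χ ⁅ i ⁆

∑δ : (i : Fin n) → sum (δ i) ≡ 1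
∑δ i = trans (∑χ ⁅ i ⁆) (∣⁅x⁆∣≡1 i)

δ-refl : (i : Fin n) → δ i i ≡ 1
δ-refl i = χ-∈ (x∈⁅x⁆ i)

δ-≢ : {i j : Fin n} → i ≢ j → δ i j ≡ 0
δ-≢ i≢j = χ-∉ (x≢y⇒x∉⁅y⁆ (≢-sym i≢j))

term≤∑ : (f : Fin n → ℕ) (i : Fin n) → f i ≤ sum f
term≤∑ f zero    = m≤m+n _ _
term≤∑ f (suc i) = ≤-trans (term≤∑ (f ∘ suc) i) (m≤n+m _ _)

two-terms≤∑ : (f : Fin n → ℕ) {i j : Fin n} → i ≢ j → f i + f j ≤ sum f
two-terms≤∑ f {zero}  {zero}  i≢j = contradiction refl i≢j
two-terms≤∑ f {zero}  {suc j} i≢j = +-monoʳ-≤ (f zero) (term≤∑ (f ∘ suc) j)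
two-terms≤∑ f {suc i} {zero}  i≢j =
  ≤-trans (≤-reflexive (+-comm (f (suc i)) (f zero))) (+-monoʳ-≤ (f zero) (term≤∑ (f ∘ suc) i))
two-terms≤∑ f {suc i} {suc j} i≢j =
  ≤-trans (two-terms≤∑ (f ∘ suc) (i≢j ∘ cong suc)) (m≤n+m _ _)

-- Lower bound by a charging argument.

module LowerBound (D : List (Subset n)) (cover : IsCover n D) (4≤n : 4 ≤ n) where

  N : ℕ
  N = length D

  H : Fin N → Subset n
  H = List.lookup D

  circuit : ∀ h → Circuit (H h)
  circuit h = All.lookup (proj₁ (proj₂ cover)) (∈-lookup h)

  -- If no triple of D sticks out of T by exactly one point, then T satisfies Φ of D,
  -- hence Φ of all triples, which fails when T contains a, b but not z.
  sticksOut : ∀ {T a b z} → a ≢ b → a ∈ T → b ∈ T → z ∉ T →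
              ∃₂ λ h v → v ∈ H h × v ∉ T × H h - v ⊆ T
  sticksOut {T} {a} {b} {z} a≢b a∈T b∈T z∉T
    with any? (λ h → any? (λ v → v ∈? H h ×-dec ¬? (v ∈? T) ×-dec (H h - v) ⊆? T))
  ... | yes found = found
  ... | no ¬found = contradiction z∈T z∉T
    where
    Φ-D : Φ (member D) T
    Φ-D G G∈D v v∈G = clause-intro v∈T
      where
      G≡ : G ≡ H (Any.index G∈D)
      G≡ = lookup-index G∈D
      v∈T : G - v ⊆ T → v ∈ T
      v∈T G-v⊆T with v ∈? T
      ... | yes v∈T = v∈T
      ... | no  v∉T = contradiction
        (Any.index G∈D , v , subst (v ∈_) G≡ v∈G , v∉T , λ {x} x∈ → G-v⊆T (subst (λ X → x ∈ X - v) (sym G≡) x∈)) ¬found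

    abz-z⊆T : triple a b z - z ⊆ T
    abz-z⊆T x∈ with ∈-⇒∈×≢ (triple a b z) x∈
    ... | x∈abz , x≢z with ∈triple⁻ x∈abz
    ...   | inj₁ refl        = a∈T
    ...   | inj₂ (inj₁ refl) = b∈T
    ...   | inj₂ (inj₂ x≡z)  = contradiction x≡z x≢z

    z∈T : z ∈ T
    z∈T = clause-elim
      (Equivalence.to (proj₂ (proj₂ cover) T) Φ-D (triple a b z)
        (triple-circuit a≢b (λ { refl → z∉T a∈T }) (λ { refl → z∉T b∈T })) z triple-thd)
      abz-z⊆T

  deg : Fin n → Fin n → ℕ
  deg u v = ∑[ h < N ] (χ (H h) u * χ (H h) v)

  incidence : ∀ {p : Subset n} {u v} → u ∈ p → v ∈ p → χ p u * χ p v ≡ 1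
  incidence u∈ v∈ = cong₂ _*_ (χ-∈ u∈) (χ-∈ v∈)

  -- Apply `sticksOut` to `{u, v}`: the triple found keeps two distinct points inside this pair,
  -- hence contains both `u` and `v`.
  deg≥1 : ∀ {u v} → u ≢ v → 1 ≤ deg u v
  deg≥1 {u} {v} u≢v
    with z , z∉ ← ∣p∣<n⇒∃∉ (⁅ u ⁆ ∪ ⁅ v ⁆) (<-≤-trans (s≤s (≤-reflexive (∣pair∣≡2 u≢v))) (≤-trans (n≤1+n 3) 4≤n))
    with h , w , w∈ , w∉ , ⊆uv ← sticksOut u≢v (x∈p∪q⁺ (inj₁ (x∈⁅x⁆ u))) (x∈p∪q⁺ (inj₂ (x∈⁅x⁆ v))) z∉
    with a , b , a≢b , a∈ , b∈ ← twoElements (circuit h) w∈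
    = ≤-trans (≤-reflexive (sym (incidence (proj₁ uv∈) (proj₂ uv∈)))) (term≤∑ _ h)
    where
    uv∈ : u ∈ H h × v ∈ H h
    uv∈ with ∈pair⁻ (⊆uv a∈) | ∈pair⁻ (⊆uv b∈) | proj₁ (∈-⇒∈×≢ (H h) a∈) | proj₁ (∈-⇒∈×≢ (H h) b∈)
    ... | inj₁ refl | inj₁ refl | _  | _  = contradiction refl a≢b
    ... | inj₁ refl | inj₂ refl | p | q = p , q
    ... | inj₂ refl | inj₁ refl | p | q = q , p
    ... | inj₂ refl | inj₂ refl | _  | _  = contradiction refl a≢b

  SharedPair : Fin N → Set
  SharedPair h = ∃₂ λ a b → a ≢ b × a ∈ H h × b ∈ H h × 2 ≤ deg a b × 2 ≤ deg b a

  -- Apply `sticksOut` to `H h` itself. The triple `g` found has a point outside `H h`, so `g`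
  -- differs from `h`, and its other two points form a pair lying in both triples.
  sharedPair : ∀ h → SharedPair h
  sharedPair h
    with z , z∉ ← ∣p∣<n⇒∃∉ (H h) (<-≤-trans (s≤s (≤-reflexive (circuit h))) 4≤n)
    with x , x∈ ← ∣p∣>0⇒Nonempty (H h) (≤-trans (s≤s z≤n) (≤-reflexive (sym (circuit h))))
    with c , d , c≢d , c∈ , d∈ ← twoElements (circuit h) x∈
    with g , w , w∈ , w∉ , ⊆H ← sticksOut c≢d (proj₁ (∈-⇒∈×≢ (H h) c∈)) (proj₁ (∈-⇒∈×≢ (H h) d∈)) z∉
    with a , b , a≢b , a∈ , b∈ ← twoElements (circuit g) w∈
    = a , b , a≢b , ⊆H a∈ , ⊆H b∈ , deg≥2 (⊆H a∈) (⊆H b∈) a∈g b∈g , deg≥2 (⊆H b∈) (⊆H a∈) b∈g a∈g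
    where
    g≢h : h ≢ g
    g≢h refl = w∉ w∈
    a∈g = proj₁ (∈-⇒∈×≢ (H g) a∈)
    b∈g = proj₁ (∈-⇒∈×≢ (H g) b∈)
    deg≥2 : ∀ {a b} → a ∈ H h → b ∈ H h → a ∈ H g → b ∈ H g → 2 ≤ deg a b
    deg≥2 ah bh ag bg =
      ≤-trans (≤-reflexive (sym (cong₂ _+_ (incidence ah bh) (incidence ag bg)))) (two-terms≤∑ _ g≢h)

  -- The charge a pair puts on each of the d triples containing it.
  weight : ℕ → ℕ
  weight 1 = 2
  weight _ = 1

  2≤d*weight : ∀ {d} → 1 ≤ d → 2 ≤ d * weight d
  2≤d*weight {1} _ = ≤-refl
  2≤d*weight {suc (suc d)} _ = s≤s (s≤s z≤n)

  weight≤2 : ∀ d → weight d ≤ 2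
  weight≤2 0 = s≤s z≤n
  weight≤2 1 = ≤-refl
  weight≤2 (suc (suc _)) = s≤s z≤n

  weight≥2 : ∀ {d} → 2 ≤ d → weight d ≡ 1
  weight≥2 (s≤s (s≤s _)) = refl

  -- With a zero diagonal, charges can be summed over all ordered pairs. Each unordered pair then
  -- counts twice, so a triple pays at most 10 in place of 5.
  ω : Fin n → Fin n → ℕ
  ω u v with u Fin.≟ v
  ... | yes _ = 0
  ... | no  _ = weight (deg u v)

  chargeAt : Fin N → Fin n → Fin n → ℕ
  chargeAt h u v = χ (H h) u * χ (H h) v * ω u v

  charge : Fin N → ℕ
  charge h = ∑[ u < n ] ∑[ v < n ] chargeAt h u v

  -- The slack 18 - charge h ≥ 8: three diagonal entries save 2 each, the shared pair saves 1 + 1.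
  saving : Subset n → (a b u v : Fin n) → ℕ
  saving p a b u v = (δ a u * δ b v + δ b u * δ a v) + 2 * (δ u v * χ p u)

  δδ≡0 : ∀ {a b : Fin n} → a ≢ b → ∀ u → δ a u * δ b u ≡ 0
  δδ≡0 {a} {b} a≢b u with a Fin.≟ u
  ... | yes refl = trans (cong (δ a a *_) (δ-≢ (≢-sym a≢b))) (*-zeroʳ (δ a a))
  ... | no  a≢u rewrite δ-≢ a≢u = refl

  -- Outside `H h` both sides vanish, because `a` and `b` lie in `H h`. On its diagonal the charge
  -- is 0 and the saving is the full 2. At `(a , b)` and `(b , a)` the weight is 1 and the saving 1.
  -- At the remaining entries the saving is 0 and the weight at most 2.
  pointwise : ∀ h {a b} → a ≢ b → a ∈ H h → b ∈ H h → 2 ≤ deg a b → 2 ≤ deg b a → ∀ u v →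
              chargeAt h u v + saving (H h) a b u v ≤ 2 * (χ (H h) u * χ (H h) v)
  pointwise h {a} {b} a≢b a∈ b∈ ab≥2 ba≥2 u v with u Fin.≟ v
  pointwise h {a} {b} a≢b a∈ b∈ ab≥2 ba≥2 u .u | yes refl
    rewrite δδ≡0 a≢b u | δδ≡0 (≢-sym a≢b) u | *-zeroʳ (χ (H h) u * χ (H h) u) | δ-refl u
    with u ∈? H h
  ... | yes u∈ rewrite χ-∈ u∈ = ≤-refl
  ... | no  u∉ rewrite χ-∉ u∉ = ≤-refl
  pointwise h {a} {b} a≢b a∈ b∈ ab≥2 ba≥2 u v | no u≢v rewrite δ-≢ u≢v with u ∈? H h | v ∈? H h
  ... | no u∉ | _ rewrite χ-∉ u∉ | δ-≢ {i = a} {u} (λ { refl → u∉ a∈ }) | δ-≢ {i = b} {u} (λ { refl → u∉ b∈ })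
      = ≤-refl
  ... | yes _ | no v∉ rewrite χ-∉ v∉ | δ-≢ {i = a} {v} (λ { refl → v∉ a∈ }) | δ-≢ {i = b} {v} (λ { refl → v∉ b∈ })
      | *-zeroʳ (χ (H h) u) | *-zeroʳ (δ a u) | *-zeroʳ (δ b u) = ≤-refl
  ... | yes u∈ | yes v∈ rewrite χ-∈ u∈ | χ-∈ v∈ with a Fin.≟ u | b Fin.≟ v
  ...   | yes refl | yes refl rewrite δ-refl a | δ-refl b | δ-≢ (≢-sym a≢b) | weight≥2 ab≥2 = ≤-refl
  ...   | yes refl | no b≢v rewrite δ-≢ b≢v | δ-≢ (≢-sym a≢b) | *-zeroʳ (δ a a)
        | +-identityʳ (weight (deg a v)) | +-identityʳ (weight (deg a v)) = weight≤2 _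
  ...   | no a≢u | _ rewrite δ-≢ a≢u with b Fin.≟ u | a Fin.≟ v
  ...     | yes refl | yes refl rewrite δ-refl a | δ-refl b | weight≥2 ba≥2 = ≤-refl
  ...     | no b≢u | _ rewrite δ-≢ b≢u
        | +-identityʳ (weight (deg u v)) | +-identityʳ (weight (deg u v)) = weight≤2 _
  ...     | yes refl | no a≢v rewrite δ-≢ a≢v | *-zeroʳ (δ b b)
        | +-identityʳ (weight (deg b v)) = ≤-trans (≤-reflexive (+-identityʳ _)) (weight≤2 _)

  ∑∑-+ : (f g : Fin n → Fin n → ℕ) →
         ∑[ u < n ] ∑[ v < n ] (f u v + g u v) ≡ ∑[ u < n ] ∑[ v < n ] f u v + ∑[ u < n ] ∑[ v < n ] g u v
  ∑∑-+ f g = trans (sum-cong-≗ (λ u → ∑-distrib-+ (f u) (g u))) (∑-distrib-+ (sum ∘ f) (sum ∘ g))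

  ∑∑-mono : (f g : Fin n → Fin n → ℕ) → (∀ u v → f u v ≤ g u v) →
            ∑[ u < n ] ∑[ v < n ] f u v ≤ ∑[ u < n ] ∑[ v < n ] g u v
  ∑∑-mono f g f≤g = ∑-mono (λ u → ∑-mono (f≤g u))

  ∑∑-2* : (f : Fin n → Fin n → ℕ) → ∑[ u < n ] ∑[ v < n ] (2 * f u v) ≡ 2 * ∑[ u < n ] ∑[ v < n ] f u v
  ∑∑-2* f = trans (sum-cong-≗ (λ u → sym (*-distribˡ-sum 2 (f u)))) (sym (*-distribˡ-sum 2 (sum ∘ f)))

  ∑∑-δ : (f : Fin n → ℕ) → ∑[ u < n ] ∑[ v < n ] (δ u v * f u) ≡ sum f
  ∑∑-δ f = sum-cong-≗ (λ u → trans (sym (*-distribʳ-sum (f u) (δ u)))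
             (trans (cong (_* f u) (∑δ u)) (*-identityˡ (f u))))

  ∑∑saving : ∀ h a b → ∑[ u < n ] ∑[ v < n ] saving (H h) a b u v ≡ 8
  ∑∑saving h a b = begin
    ∑[ u < n ] ∑[ v < n ] saving (H h) a b u v
      ≡⟨ ∑∑-+ (λ u v → δ a u * δ b v + δ b u * δ a v) (λ u v → 2 * (δ u v * χ (H h) u)) ⟩
    ∑[ u < n ] ∑[ v < n ] (δ a u * δ b v + δ b u * δ a v) + ∑[ u < n ] ∑[ v < n ] (2 * (δ u v * χ (H h) u))
      ≡⟨ cong₂ _+_ (∑∑-+ (λ u v → δ a u * δ b v) (λ u v → δ b u * δ a v)) (∑∑-2* (λ u v → δ u v * χ (H h) u)) ⟩
    (∑[ u < n ] ∑[ v < n ] (δ a u * δ b v) + ∑[ u < n ] ∑[ v < n ] (δ b u * δ a v))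
      + 2 * ∑[ u < n ] ∑[ v < n ] (δ u v * χ (H h) u)
      ≡⟨ cong₂ _+_ (cong₂ _+_ (∑∑-* (δ a) (δ b)) (∑∑-* (δ b) (δ a))) (cong (2 *_) (∑∑-δ (χ (H h)))) ⟩
    (sum (δ a) * sum (δ b) + sum (δ b) * sum (δ a)) + 2 * sum (χ (H h))
      ≡⟨ cong₂ (λ x y → (x * y + y * x) + 2 * sum (χ (H h))) (∑δ a) (∑δ b) ⟩
    2 + 2 * sum (χ (H h))
      ≡⟨ cong (λ x → 2 + 2 * x) (trans (∑χ (H h)) (circuit h)) ⟩
    8 ∎
    where open ≡-Reasoning

  -- Sum the entrywise bound: the double sum of `χ u * χ v` factors as `3 * 3`, which gives `18`.
  charge+saving≤ : ∀ h {a b} → (∀ u v → chargeAt h u v + saving (H h) a b u v ≤ 2 * (χ (H h) u * χ (H h) v)) →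
                   charge h + 8 ≤ 18
  charge+saving≤ h {a} {b} bound = begin
    charge h + 8
      ≡⟨ cong (charge h +_) (∑∑saving h a b) ⟨
    charge h + ∑[ u < n ] ∑[ v < n ] saving (H h) a b u v
      ≡⟨ ∑∑-+ (chargeAt h) (saving (H h) a b) ⟨
    ∑[ u < n ] ∑[ v < n ] (chargeAt h u v + saving (H h) a b u v)
      ≤⟨ ∑∑-mono (λ u v → chargeAt h u v + saving (H h) a b u v) (λ u v → 2 * (χ (H h) u * χ (H h) v)) bound ⟩
    ∑[ u < n ] ∑[ v < n ] (2 * (χ (H h) u * χ (H h) v))
      ≡⟨ ∑∑-2* (λ u v → χ (H h) u * χ (H h) v) ⟩
    2 * ∑[ u < n ] ∑[ v < n ] (χ (H h) u * χ (H h) v)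
      ≡⟨ cong (2 *_) (∑∑-* (χ (H h)) (χ (H h))) ⟩
    2 * (sum (χ (H h)) * sum (χ (H h)))
      ≡⟨ cong (λ x → 2 * (x * x)) (trans (∑χ (H h)) (circuit h)) ⟩
    18 ∎
    where open ≤-Reasoning

  charge≤10 : ∀ h → charge h ≤ 10
  charge≤10 h = bound (sharedPair h)
    where
    bound : SharedPair h → charge h ≤ 10
    bound (a , b , a≢b , a∈ , b∈ , ab≥2 , ba≥2) =
      +-cancelʳ-≤ 8 (charge h) 10 (charge+saving≤ h {a} {b} (pointwise h a≢b a∈ b∈ ab≥2 ba≥2))

  -- Double counting: exchanging the sums collects, for each pair, the triples that contain it.
  ∑charge : ∑[ h < N ] charge h ≡ ∑[ u < n ] ∑[ v < n ] (deg u v * ω u v)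
  ∑charge = begin
    ∑[ h < N ] ∑[ u < n ] ∑[ v < n ] chargeAt h u v
      ≡⟨ ∑-comm (λ h u → ∑[ v < n ] chargeAt h u v) ⟩
    ∑[ u < n ] ∑[ h < N ] ∑[ v < n ] chargeAt h u v
      ≡⟨ sum-cong-≗ (λ u → ∑-comm (λ h v → chargeAt h u v)) ⟩
    ∑[ u < n ] ∑[ v < n ] ∑[ h < N ] chargeAt h u v
      ≡⟨ sum-cong-≗ (λ u → sum-cong-≗ (λ v → *-distribʳ-sum (ω u v) (λ h → χ (H h) u * χ (H h) v))) ⟨
    ∑[ u < n ] ∑[ v < n ] (deg u v * ω u v) ∎
    where open ≡-Reasoning

  -- The delta term lifts the uncharged diagonal to 2, so that the bound holds at all `n * n`
  -- entries; it costs `2 * n` in total. The factor `1` gives the shape that `∑∑-δ` expects.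
  pair-charged : ∀ u v → 2 ≤ deg u v * ω u v + 2 * (δ u v * 1)
  pair-charged u v with u Fin.≟ v
  ... | yes refl rewrite δ-refl u = m≤n+m 2 _
  ... | no  u≢v = ≤-trans (2≤d*weight (deg≥1 u≢v)) (m≤m+n _ _)

  n²≤5N+n : n * n ≤ 5 * N + n
  n²≤5N+n = *-cancelˡ-≤ 2 (begin
    2 * (n * n)
      ≡⟨ lemma₀ n ⟩
    n * (n * 2)
      ≡⟨ trans (sum-cong-≗ {n} (λ u → ∑-const n 2)) (∑-const n (n * 2)) ⟨
    ∑[ u < n ] ∑[ v < n ] 2
      ≤⟨ ∑∑-mono (λ _ _ → 2) (λ u v → deg u v * ω u v + 2 * (δ u v * 1)) pair-charged ⟩
    ∑[ u < n ] ∑[ v < n ] (deg u v * ω u v + 2 * (δ u v * 1))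
      ≡⟨ ∑∑-+ (λ u v → deg u v * ω u v) (λ u v → 2 * (δ u v * 1)) ⟩
    ∑[ u < n ] ∑[ v < n ] (deg u v * ω u v) + ∑[ u < n ] ∑[ v < n ] (2 * (δ u v * 1))
      ≡⟨ cong₂ _+_ (sym ∑charge) (trans (∑∑-2* (λ u v → δ u v * 1)) (cong (2 *_) (trans (∑∑-δ (λ _ → 1)) (∑-const n 1)))) ⟩
    ∑[ h < N ] charge h + 2 * (n * 1)
      ≤⟨ +-monoˡ-≤ _ (≤-trans (∑-mono charge≤10) (≤-reflexive (∑-const N 10))) ⟩
    N * 10 + 2 * (n * 1)
      ≡⟨ lemma N n ⟩
    2 * (5 * N + n) ∎)
    where
    open ≤-Reasoning
    lemma : ∀ N n → N * 10 + 2 * (n * 1) ≡ 2 * (5 * N + n)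
    lemma = solve-∀
    lemma₀ : ∀ n → 2 * (n * n) ≡ n * (n * 2)
    lemma₀ = solve-∀

-- Existence of a minimum cover by decidable search.

_≟ˢ_ : DecidableEquality (Subset n)
_≟ˢ_ = ≡-dec Bool._≟_

allSubset? : {P : Subset n → Set} → Decidable P → Dec (∀ p → P p)
allSubset? P? = map′ (λ ¬∃¬ p → decidable-stable (P? p) (λ ¬Pp → ¬∃¬ (p , ¬Pp)))
                     (λ ∀P (p , ¬Pp) → ¬Pp (∀P p))
                     (¬? (anySubset? (¬? ∘ P?)))

_⇔-dec_ : {A B : Set} → Dec A → Dec B → Dec (A ⇔ B)
a? ⇔-dec b? = map′ (λ (f , g) → mk⇔ f g) (λ e → Equivalence.to e , Equivalence.from e)
                   ((a? →-dec b?) ×-dec (b? →-dec a?))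

Φ? : {ℋ : Subset n → Set} → Decidable ℋ → Decidable (Φ ℋ)
Φ? ℋ? T = allSubset? λ p → ℋ? p →-dec all? λ v → v ∈? p →-dec
            (¬? ((p - v) ⊆? T) ⊎-dec ((p - v) ∪ ⁅ v ⁆) ⊆? T)

isCover? : ∀ n → Decidable (IsCover n)
isCover? n D = DecUnique.unique? _≟ˢ_ D ×-dec All.all? circuit? D
  ×-dec allSubset? λ T → Φ? (λ p → Any.any? (p ≟ˢ_) D) T ⇔-dec Φ? circuit? T
  where
  circuit? : Decidable Circuit
  circuit? p = ∣ p ∣ ≟ 3

anyListOfLength? : {P : List (Subset n) → Set} → Decidable P → ∀ m → Dec (∃ λ D → P D × length D ≡ m)
anyListOfLength? P? zero =
  map′ (λ P[] → [] , P[] , refl) (λ { ([] , P[] , _) → P[] }) (P? [])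
anyListOfLength? P? (suc m) =
  map′ (λ (p , D , PD , eq) → p ∷ D , PD , cong suc eq)
       (λ { (p ∷ D , PD , eq) → p , D , PD , suc-injective eq })
       (anySubset? λ p → anyListOfLength? (P? ∘ (p ∷_)) m)

least : {P : ℕ → Set} → Decidable P → ∀ m → P m → ∃ λ k → P k × (∀ j → P j → k ≤ j)
least P? m Pm with P? 0
... | yes P0 = 0 , P0 , λ _ _ → z≤n
least P? zero    Pm | no ¬P0 = contradiction Pm ¬P0
least {P} P? (suc m) Pm | no ¬P0 with k , Pk , k-least ← least (P? ∘ suc) m Pm = suc k , Pk , suc-least
  where
  suc-least : ∀ j → P j → suc k ≤ j
  suc-least zero    P0 = contradiction P0 ¬P0
  suc-least (suc j) Pj = s≤s (k-least j Pj)

-- Whether a cover of a given length exists is decidable, since there are finitely many lists of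
-- subsets of that length. One known cover bounds the search for the least such length.
minCoverSize : (D : List (Subset n)) → IsCover n D → ∃ (IsMinCoverSize n)
minCoverSize {n} D cover with m , ∃D , m-least ← least (anyListOfLength? (isCover? n)) (length D) (D , cover , refl)
  = m , ∃D , λ E coverE → m-least (length E) (E , coverE , refl)

-- Translates of triples on the cyclic group.

length-cartesianProductWith : {A B C : Set} (f : A → B → C) (xs : List A) (ys : List B) →
                              length (cartesianProductWith f xs ys) ≡ length xs * length ys
length-cartesianProductWith f []       ys = refl
length-cartesianProductWith f (x ∷ xs) ys = trans (length-++ (map (f x) ys))
  (cong₂ _+_ (length-map (f x) ys) (length-cartesianProductWith f xs ys))

m≤m+n≡o : ∀ {m o} n → m + n ≡ o → m ≤ o
m≤m+n≡o {m} n refl = m≤m+n m n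

module _ {n : ℕ} .{{_ : NonZero n}} where

  point : ℕ → Fin n
  point i = i mod n

  toℕ-point : ∀ i → toℕ (point i) ≡ i % n
  toℕ-point i = toℕ-fromℕ< (m%n<n i n)

  point-cong : ∀ {i j} → i % n ≡ j % n → point i ≡ point j
  point-cong {i} {j} eq = toℕ-injective (trans (toℕ-point i) (trans eq (sym (toℕ-point j))))

  point-toℕ : ∀ a → point (toℕ a) ≡ a
  point-toℕ a = toℕ-injective (trans (toℕ-point (toℕ a)) (m<n⇒m%n≡m (toℕ<n a)))

  point-+* : ∀ i k → point (i + k * n) ≡ point i
  point-+* i k = point-cong ([m+kn]%n≡m%n i k n)

  point-% : ∀ i d → point (i % n + d) ≡ point (i + d)
  point-% i d = sym (trans (cong point eq) (point-+* (i % n + d) (i / n)))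
    where
    shuffle : ∀ r q d → r + q + d ≡ r + d + q
    shuffle = solve-∀
    eq : i + d ≡ i % n + d + i / n * n
    eq = trans (cong (_+ d) (m≡m%n+[m/n]*n i n)) (shuffle (i % n) (i / n * n) d)

  point-≢ : ∀ i {d} → 0 < d → d < n → point i ≢ point (i + d)
  point-≢ i {d} 0<d d<n eq = <⇒≱ d<n (∣⇒≤ {{>-nonZero 0<d}} n∣d)
    where
    open ≡-Reasoning
    r = i % n
    same : r ≡ (i + d) % n
    same = trans (sym (toℕ-point i)) (trans (cong toℕ eq) (toℕ-point (i + d)))
    n∣d : n ∣ d
    n∣d = ∣m+n∣m⇒∣n (subst (n ∣_) (sym (+-cancelˡ-≡ r _ _ (begin
      r + (i / n * n + d)          ≡⟨ +-assoc r _ d ⟨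
      r + i / n * n + d            ≡⟨ cong (_+ d) (m≡m%n+[m/n]*n i n) ⟨
      i + d                        ≡⟨ m≡m%n+[m/n]*n (i + d) n ⟩
      (i + d) % n + (i + d) / n * n ≡⟨ cong (_+ (i + d) / n * n) same ⟨
      r + (i + d) / n * n          ∎))) (n∣m*n ((i + d) / n))) (n∣m*n (i / n))

  -- A pair `(d , e)` records two consecutive gaps of a triple on the cycle; its translates realise
  -- the differences `d`, `e` and `d + e`.
  translate : ℕ × ℕ → ℕ → Subset n
  translate (d , e) i = triple (point i) (point (i + d)) (point (i + d + e))

  -- This allows any natural number as base point although `orbits` lists only those below `n`.
  translate-% : ∀ g i → translate g (i % n) ≡ translate g i
  translate-% (d , e) i rewrite +-assoc (i % n) d e | +-assoc i d e | point-% i d | point-% i (d + e)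
    | point-cong (m%n%n≡m%n i n) = refl

  -- Removing duplicates provides the uniqueness that a cover requires and can only shorten the
  -- list.
  orbits : List (ℕ × ℕ) → List (Subset n)
  orbits gaps = deduplicate _≟ˢ_ (cartesianProductWith translate gaps (upTo n))

  ∈-orbits : ∀ {gaps g} → g ∈ˡ gaps → ∀ i → translate g i ∈ˡ orbits gaps
  ∈-orbits {gaps} {g} g∈ i = subst (_∈ˡ orbits gaps) (translate-% g i)
    (∈-deduplicate⁺ _≟ˢ_ (∈-cartesianProductWith⁺ translate g∈ (∈-upTo⁺ (m%n<n i n))))

  length-orbits : ∀ gaps → length (orbits gaps) ≤ length gaps * n
  length-orbits gaps = ≤-trans (length-deduplicate _≟ˢ_ (cartesianProductWith translate gaps (upTo n)))
    (≤-reflexive (trans (length-cartesianProductWith translate gaps (upTo n)) (cong (length gaps *_) (length-upTo n))))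

  Valid : ℕ × ℕ → Set
  Valid (d , e) = 0 < d × 0 < e × d + e < n

  module _ {d e : ℕ} (valid : Valid (d , e)) where

    point-fst≢snd : ∀ i → point i ≢ point (i + d)
    point-fst≢snd i = point-≢ i (proj₁ valid) (m+n≤o⇒m≤o (suc d) (proj₂ (proj₂ valid)))

    point-fst≢thd : ∀ i → point i ≢ point (i + d + e)
    point-fst≢thd i eq = point-≢ i (≤-trans (proj₁ valid) (m≤m+n d e)) (proj₂ (proj₂ valid))
      (trans eq (cong point (+-assoc i d e)))

    point-snd≢thd : ∀ i → point (i + d) ≢ point (i + d + e)
    point-snd≢thd i = point-≢ (i + d) (proj₁ (proj₂ valid))
      (≤-trans (s≤s (m≤n+m e d)) (proj₂ (proj₂ valid)))

    translate-circuit : ∀ i → Circuit (translate (d , e) i)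
    translate-circuit i = triple-circuit (point-fst≢snd i) (point-fst≢thd i) (point-snd≢thd i)

  -- Closure of a set under the translated triples.

  module Closed {gaps : List (ℕ × ℕ)}
                {T : Subset n} (closed : Φ (member (orbits gaps)) T) where

    P : ℕ → Set
    P i = point i ∈ T

    P-+* : ∀ {i} k → P i → P (i + k * n)
    P-+* {i} k = subst (_∈ T) (sym (point-+* i k))

    close : ∀ {g} → g ∈ˡ gaps → ∀ i {x} → x ∈ translate g i →
            (∀ {y} → y ∈ translate g i → y ≢ x → y ∈ T) → x ∈ T
    close {g} g∈ i {x} x∈ rest = clause-elim (closed (translate g i) (∈-orbits g∈ i) x x∈)
      (λ y∈ → let y∈g , y≢x = ∈-⇒∈×≢ (translate g i) y∈ in rest y∈g y≢x)

    module _ {d e : ℕ} (g∈ : (d , e) ∈ˡ gaps) (i : ℕ) where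

      close-fst : P (i + d) → P (i + d + e) → P i
      close-fst Pd Pe = close g∈ i triple-fst (rest ∘ ∈triple⁻)
        where
        rest : ∀ {y} → y ≡ point i ⊎ y ≡ point (i + d) ⊎ y ≡ point (i + d + e) → y ≢ point i → y ∈ T
        rest (inj₁ y≡)          y≢ = contradiction y≡ y≢
        rest (inj₂ (inj₁ refl)) _  = Pd
        rest (inj₂ (inj₂ refl)) _  = Pe

      close-snd : P i → P (i + d + e) → P (i + d)
      close-snd Pi Pe = close g∈ i triple-snd (rest ∘ ∈triple⁻)
        where
        rest : ∀ {y} → y ≡ point i ⊎ y ≡ point (i + d) ⊎ y ≡ point (i + d + e) → y ≢ point (i + d) → y ∈ T
        rest (inj₁ refl)        _  = Pi
        rest (inj₂ (inj₁ y≡))   y≢ = contradiction y≡ y≢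
        rest (inj₂ (inj₂ refl)) _  = Pe

      close-thd : P i → P (i + d) → P (i + d + e)
      close-thd Pi Pd = close g∈ i triple-thd (rest ∘ ∈triple⁻)
        where
        rest : ∀ {y} → y ≡ point i ⊎ y ≡ point (i + d) ⊎ y ≡ point (i + d + e) → y ≢ point (i + d + e) → y ∈ T
        rest (inj₁ refl)        _  = Pi
        rest (inj₂ (inj₁ refl)) _  = Pd
        rest (inj₂ (inj₂ y≡))   y≢ = contradiction y≡ y≢

    Has : ℕ → Set
    Has d = ∃ λ i → P i × P (i + d)

    -- Place the triple so that its last two points are the given pair; its first point lies `d`
    -- before them.
    has-fst : ∀ {d e} → (d , e) ∈ˡ gaps → Has e → Has d
    has-fst {d} {e} g∈ (i , Pi , Pe) = j , close-fst g∈ j Pj+d Pj+d+e , Pj+d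
      where
      -- This is `i - d` modulo `n`, written without subtraction.
      j = i + d * pred n
      j+d : i + d * n ≡ j + d
      j+d = trans (cong (λ m → i + d * m) (sym (suc-pred n))) (shuffle i d (pred n))
        where
        shuffle : ∀ i d m → i + d * suc m ≡ i + d * m + d
        shuffle = solve-∀
      j+d+e : i + e + d * n ≡ j + d + e
      j+d+e = trans (shuffle i e (d * n)) (cong (_+ e) j+d)
        where
        shuffle : ∀ i e m → i + e + m ≡ i + m + e
        shuffle = solve-∀
      Pj+d : P (j + d)
      Pj+d = subst P j+d (P-+* d Pi)
      Pj+d+e : P (j + d + e)
      Pj+d+e = subst P j+d+e (P-+* d Pe)

    has-sum : ∀ {d e} → (d , e) ∈ˡ gaps → Has (d + e) → Has d
    has-sum {d} {e} g∈ (i , Pi , Pd+e) = i , Pi , close-snd g∈ i Pi (subst P (sym (+-assoc i d e)) Pd+e)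

    -- Both triples are placed on the same pair at distance `d`; their third points are `q` apart.
    has-diff : ∀ {d e q} → (d , e) ∈ˡ gaps → (d , e + q) ∈ˡ gaps → Has d → Has q
    has-diff {d} {e} {q} g∈ g′∈ (i , Pi , Pd) = i + d + e , close-thd g∈ i Pi Pd ,
      subst P (sym (+-assoc (i + d) e q)) (close-thd g′∈ i Pi Pd)

    module _ (11∈ : (1 , 1) ∈ˡ gaps) where

      spread : ∀ {i} → P i → P (i + 1) → ∀ m → P (m + i)
      spread {i} Pi Pi+1 m = proj₁ (go m)
        where
        go : ∀ m → P (m + i) × P (m + i + 1)
        go zero = Pi , Pi+1
        go (suc m) with Pm , Pm+1 ← go m =
          subst P (+-comm (m + i) 1) Pm+1 , subst P (cong (_+ 1) (+-comm (m + i) 1)) (close-thd 11∈ (m + i) Pm Pm+1)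

      -- The pair at distance `d` forces the point just after its second point. Two consecutive
      -- points are then present, and `spread` carries them around the cycle.
      extra : ∀ {d} → (d , 1) ∈ˡ gaps → Has d → ∀ m → P m
      extra {d} d∈ (i , Pi , Pd) m = subst (_∈ T) (point-+* m j)
        -- From `j`, a further `m + j * pred n` steps lead to `m + j * n`, which is the point `m`.
        (subst P eq (spread Pd (close-thd d∈ i Pi Pd) (m + j * pred n)))
        where
        j = i + d
        shuffle : ∀ m j k → m + j * k + j ≡ m + j * suc k
        shuffle = solve-∀
        eq : m + j * pred n + j ≡ m + j * n
        eq = trans (shuffle m j (pred n)) (cong (λ x → m + j * x) (suc-pred n))

-- The base triples and the differences they use.

-- With k = s ∸ suc j, the differences x = b + k run through [b, b + s) and p + x = b + (s + q) + j
-- through [b + s + q, b + 2 s + q), where p = suc q + 2 j.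
family : (s q b : ℕ) → List (ℕ × ℕ)
family s q b = applyUpTo (λ j → suc q + 2 * j , b + (s ∸ suc j)) s

-- Writing `s` as `j + suc k` turns the truncated subtraction `s ∸ suc j` into the plain variable
-- `k`.
complement : ∀ {j s} → j < s → ∃ λ k → j + suc k ≡ s
complement {j} j<s with k , eq ← m≤n⇒∃[o]m+o≡n j<s = k , trans (+-suc j k) eq

s∸suc : ∀ j k → (j + suc k) ∸ suc j ≡ k
s∸suc j k = trans (cong (_∸ suc j) (+-suc j k)) (m+n∸m≡n j k)

family-∈ : ∀ {s} q b {j k} → j + suc k ≡ s → (suc q + 2 * j , b + k) ∈ˡ family s q b
family-∈ q b {j} {k} refl = subst (λ k′ → (suc q + 2 * j , b + k′) ∈ˡ family (j + suc k) q b) (s∸suc j k)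
  (∈-applyUpTo⁺ (λ j′ → suc q + 2 * j′ , b + ((j + suc k) ∸ suc j′)) (m<m+n j z<s))

-- The distance `1` propagates consecutive points. `2 * s` and `2 * s + 1` are the differences
-- between second gaps for equal `p` in the two odd and the two even families. `7 * s + 1` and
-- `9 * s + 2` are the holes that the even families leave, and the last eight distances run from
-- `10 * s + 3` to `10 * s + 10`.
extras : ℕ → List ℕ
extras s = 1 ∷ 2 * s ∷ 2 * s + 1 ∷ 7 * s + 1 ∷ 9 * s + 2 ∷ applyUpTo (λ r → 10 * s + 3 + r) 8

-- The four families use the blocks from `2 * s + 1`, `4 * s + 1`, `6 * s + 1` and `8 * s + 2` up to
-- `10 * s + 2`, each block ending where the next begins. Each odd `p` occurs in the first two and
-- each even `p` in the last two.
bases : ℕ → List (ℕ × ℕ)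
bases s = family s 0 (2 * s + 1) ++ family s 0 (4 * s + 1)
       ++ family s 1 (6 * s + 1) ++ family s 1 (8 * s + 2) ++ map (_, 1) (extras s)

length-family-++ : ∀ s q b {gs l} → length gs ≡ l → length (family s q b ++ gs) ≡ s + l
length-family-++ s q b eq = trans (length-++ (family s q b)) (cong₂ _+_ (length-applyUpTo _ s) eq)

length-bases : ∀ s → length (bases s) ≡ 4 * s + 13
length-bases s = trans
  (length-family-++ s 0 (2 * s + 1) (length-family-++ s 0 (4 * s + 1)
    (length-family-++ s 1 (6 * s + 1) (length-family-++ s 1 (8 * s + 2) (length-map (_, 1) (extras s))))))
  (shuffle s)
  where
  shuffle : ∀ s → s + (s + (s + (s + 13))) ≡ 4 * s + 13
  shuffle = solve-∀

module _ (s : ℕ) where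

  odd₁⊆bases : ∀ {g} → g ∈ˡ family s 0 (2 * s + 1) → g ∈ˡ bases s
  odd₁⊆bases = ∈-++⁺ˡ

  odd₂⊆bases : ∀ {g} → g ∈ˡ family s 0 (4 * s + 1) → g ∈ˡ bases s
  odd₂⊆bases = ∈-++⁺ʳ (family s 0 (2 * s + 1)) ∘ ∈-++⁺ˡ

  even₁⊆bases : ∀ {g} → g ∈ˡ family s 1 (6 * s + 1) → g ∈ˡ bases s
  even₁⊆bases = ∈-++⁺ʳ (family s 0 (2 * s + 1)) ∘ ∈-++⁺ʳ (family s 0 (4 * s + 1)) ∘ ∈-++⁺ˡ

  even₂⊆bases : ∀ {g} → g ∈ˡ family s 1 (8 * s + 2) → g ∈ˡ bases s
  even₂⊆bases = ∈-++⁺ʳ (family s 0 (2 * s + 1)) ∘ ∈-++⁺ʳ (family s 0 (4 * s + 1)) ∘ ∈-++⁺ʳ (family s 1 (6 * s + 1)) ∘ ∈-++⁺ˡ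

  extras⊆bases : ∀ {d} → d ∈ˡ extras s → (d , 1) ∈ˡ bases s
  extras⊆bases = ∈-++⁺ʳ (family s 0 (2 * s + 1)) ∘ ∈-++⁺ʳ (family s 0 (4 * s + 1)) ∘ ∈-++⁺ʳ (family s 1 (6 * s + 1))
     ∘ ∈-++⁺ʳ (family s 1 (8 * s + 2)) ∘ ∈-map⁺ (_, 1)

-- Each use peels off one block, so a chain of uses tiles a range of distances.
interval : {Q : ℕ → Set} {b : ℕ} (a w : ℕ) → (∀ k → k < w → Q (a + k)) → a + w ≡ b →
           (∀ d → b ≤ d → Q d) → ∀ d → a ≤ d → Q d
interval a w here′ refl beyond d a≤d with k , refl ← m≤n⇒∃[o]m+o≡n a≤d with k <? w
... | yes k<w = here′ k k<w
... | no  k≮w = beyond (a + k) (+-monoʳ-≤ a (≮⇒≥ k≮w))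

evenOrOdd : ∀ k → ∃ λ j → k ≡ 2 * j ⊎ k ≡ suc (2 * j)
evenOrOdd zero = 0 , inj₁ refl
evenOrOdd (suc k) with evenOrOdd k
... | j , inj₁ refl = j , inj₂ refl
... | j , inj₂ refl = suc j , inj₁ (shuffle j)
  where
  shuffle : ∀ j → suc (suc (2 * j)) ≡ 2 * suc j
  shuffle = solve-∀

-- The cyclic cover and its verification.

module Construction {n : ℕ} .{{_ : NonZero n}} (s : ℕ) (0<s : 0 < s)
                    (small : 10 * s + 11 < n) (large : n ≤ 20 * s + 19) where

  family-valid : ∀ q b → 0 < b → suc q + b + 2 * s ≤ 10 * s + 11 → All Valid (family s q b)
  family-valid q b 0<b bound = All.applyUpTo⁺₁ (λ j → suc q + 2 * j , b + (s ∸ suc j)) s λ {j} j<s → valid j j<s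
    where
    shuffle : ∀ q j b k → suc q + 2 * j + (b + k) + (k + 2) ≡ suc q + b + 2 * (j + suc k)
    shuffle = solve-∀
    valid : ∀ j → j < s → Valid {n} (suc q + 2 * j , b + (s ∸ suc j))
    valid j j<s with k , refl ← complement j<s rewrite s∸suc j k =
      z<s , ≤-trans 0<b (m≤m+n b k) ,
      ≤-<-trans (m≤m+n≡o (k + 2) (shuffle q j b k)) (≤-<-trans bound small)

  -- The largest total gap among all base triples is `10 * s + 11`, reached here at
  -- `d = 10 * s + 10`; `small` is sized for it.
  extra-valid : ∀ {d} → 0 < d → d ≤ 10 * s + 10 → Valid {n} (d , 1)
  extra-valid 0<d d≤ = 0<d , z<s , ≤-<-trans (≤-trans (+-monoˡ-≤ 1 d≤) (≤-reflexive (shuffle s))) small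
    where
    shuffle : ∀ s → 10 * s + 10 + 1 ≡ 10 * s + 11
    shuffle = solve-∀

  extras-valid : All (λ d → Valid {n} (d , 1)) (extras s)
  extras-valid =
      extra-valid z<s (m≤m+n≡o (10 * s + 9) (f₁ s))
    ∷ extra-valid (*-mono-≤ {1} {2} z<s 0<s) (m≤m+n≡o (8 * s + 10) (f₂ s))
    ∷ extra-valid (m≤n+m 1 _) (m≤m+n≡o (8 * s + 9) (f₃ s))
    ∷ extra-valid (m≤n+m 1 _) (m≤m+n≡o (3 * s + 9) (f₄ s))
    ∷ extra-valid (≤-trans z<s (m≤n+m 2 _)) (m≤m+n≡o (s + 8) (f₅ s))
    ∷ All.applyUpTo⁺₁ (λ r → 10 * s + 3 + r) 8 λ {r} r<8 → extra-valid (≤-trans z<s (≤-trans (m≤n+m 3 (10 * s)) (m≤m+n _ r)))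
        (≤-trans (+-monoʳ-≤ (10 * s + 3) (s≤s⁻¹ r<8)) (≤-reflexive (+-assoc (10 * s) 3 7)))
    where
    f₁ : ∀ s → 1 + (10 * s + 9) ≡ 10 * s + 10
    f₁ = solve-∀
    f₂ : ∀ s → 2 * s + (8 * s + 10) ≡ 10 * s + 10
    f₂ = solve-∀
    f₃ : ∀ s → 2 * s + 1 + (8 * s + 9) ≡ 10 * s + 10
    f₃ = solve-∀
    f₄ : ∀ s → 7 * s + 1 + (3 * s + 9) ≡ 10 * s + 10
    f₄ = solve-∀
    f₅ : ∀ s → 9 * s + 2 + (s + 8) ≡ 10 * s + 10
    f₅ = solve-∀

  bases-valid : All Valid (bases s)
  bases-valid =
    All.++⁺ (family-valid 0 (2 * s + 1) (m≤n+m 1 _) (m≤m+n≡o (6 * s + 9) (e₁ s)))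
    (All.++⁺ (family-valid 0 (4 * s + 1) (m≤n+m 1 _) (m≤m+n≡o (4 * s + 9) (e₂ s)))
    (All.++⁺ (family-valid 1 (6 * s + 1) (m≤n+m 1 _) (m≤m+n≡o (2 * s + 8) (e₃ s)))
    (All.++⁺ (family-valid 1 (8 * s + 2) (≤-trans z<s (m≤n+m 2 _)) (m≤m+n≡o 7 (e₄ s)))
    (All.map⁺ {f = _, 1} extras-valid))))
    where
    e₁ : ∀ s → 1 + (2 * s + 1) + 2 * s + (6 * s + 9) ≡ 10 * s + 11
    e₁ = solve-∀
    e₂ : ∀ s → 1 + (4 * s + 1) + 2 * s + (4 * s + 9) ≡ 10 * s + 11
    e₂ = solve-∀
    e₃ : ∀ s → 2 + (6 * s + 1) + 2 * s + (2 * s + 8) ≡ 10 * s + 11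
    e₃ = solve-∀
    e₄ : ∀ s → 2 + (8 * s + 2) + 2 * s + 7 ≡ 10 * s + 11
    e₄ = solve-∀

  D : List (Subset n)
  D = orbits (bases s)

  D-circuits : All Circuit D
  D-circuits = All.tabulate circuit
    where
    circuit : ∀ {p} → p ∈ˡ D → Circuit p
    circuit p∈ with g , i , g∈ , _ , refl ← ∈-cartesianProductWith⁻ translate (bases s) (upTo n)
                      (∈-deduplicate⁻ _≟ˢ_ _ p∈)
      = translate-circuit (All.lookup bases-valid g∈) i

  -- Saturation of closed sets.

  module Saturation {T : Subset n} (closed : Φ (member D) T) where
    open Closed {gaps = bases s} {T = T} closed

    Full : ℕ → Set
    Full d = Has d → ∀ m → P m

    full-extra : ∀ {d} → d ∈ˡ extras s → Full d
    full-extra d∈ = extra (extras⊆bases s (here refl)) (extras⊆bases s d∈)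

    -- For the same `p`, the second gaps in the two odd families differ by `2 * s`, so `has-diff`
    -- produces a pair at that extra distance.
    full-odd : ∀ {j k} → j + suc k ≡ s → Full (1 + 2 * j)
    full-odd {j} {k} eq has = full-extra (there (here refl))
      (has-diff {e = 2 * s + 1 + k} (odd₁⊆bases s (family-∈ 0 (2 * s + 1) eq))
        (subst (λ e → (1 + 2 * j , e) ∈ˡ bases s) (shuffle s k) (odd₂⊆bases s (family-∈ 0 (4 * s + 1) eq))) has)
      where
      shuffle : ∀ s k → 4 * s + 1 + k ≡ 2 * s + 1 + k + 2 * s
      shuffle = solve-∀

    -- As for odd `p`, but the bases `6 * s + 1` and `8 * s + 2` differ by the extra distance
    -- `2 * s + 1`.
    full-even : ∀ {j k} → j + suc k ≡ s → Full (2 + 2 * j)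
    full-even {j} {k} eq has = full-extra (there (there (here refl)))
      (has-diff {e = 6 * s + 1 + k} (even₁⊆bases s (family-∈ 1 (6 * s + 1) eq))
        (subst (λ e → (2 + 2 * j , e) ∈ˡ bases s) (shuffle s k) (even₂⊆bases s (family-∈ 1 (8 * s + 2) eq))) has)
      where
      shuffle : ∀ s k → 8 * s + 2 + k ≡ 6 * s + 1 + k + (2 * s + 1)
      shuffle = solve-∀

    full-short : ∀ k → k < 2 * s → Full (1 + k)
    full-short k k<2s with evenOrOdd k
    ... | j , inj₁ refl = full-odd (proj₂ (complement (*-cancelˡ-< 2 j s k<2s)))
    ... | j , inj₂ refl = full-even (proj₂ (complement (*-cancelˡ-< 2 j s (<-trans (n<1+n (2 * j)) k<2s))))

    module _ (q b : ℕ) (b∈ : ∀ {g} → g ∈ˡ family s q b → g ∈ˡ bases s)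
             (full : ∀ {j k} → j + suc k ≡ s → Full (suc q + 2 * j)) where

      -- The distance is the second gap of the triple whose index `j` is complementary to `k`;
      -- closing that triple yields its first gap `p`, where `full` applies.
      full-low : ∀ k → k < s → Full (b + k)
      full-low k k<s has with j , eq ← complement k<s =
        full eq′ (has-fst (b∈ (family-∈ q b eq′)) has)
        where
        eq′ : j + suc k ≡ s
        eq′ = trans (shuffle j k) eq
          where
          shuffle : ∀ j k → j + suc k ≡ k + suc j
          shuffle = solve-∀

      -- Here the distance joins the outer points of the triple with index `j`; its middle point
      -- again yields `p`.
      full-high : ∀ j → j < s → Full (b + (s + q) + j)
      full-high j j<s has with k , eq ← complement j<s =
        full eq (has-sum (b∈ (family-∈ q b eq)) (subst Has eq′ has))
        where
        shuffle : ∀ q b j k → b + (j + suc k + q) + j ≡ suc q + 2 * j + (b + k)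
        shuffle = solve-∀
        eq′ : b + (s + q) + j ≡ suc q + 2 * j + (b + k)
        eq′ = trans (cong (λ s → b + (s + q) + j) (sym eq)) (shuffle q b j k)

    full-singleton : ∀ a → a ∈ˡ extras s → ∀ k → k < 1 → Full (a + k)
    full-singleton a a∈ zero _ = subst Full (sym (+-identityʳ a)) (full-extra a∈)
    full-singleton a a∈ (suc k) (s≤s ())

    full-long : ∀ r → r < 8 → Full (10 * s + 3 + r)
    full-long r r<8 = full-extra
      (there (there (there (there (there (∈-applyUpTo⁺ (λ r → 10 * s + 3 + r) r<8))))))

    full-all : ∀ d → 1 ≤ d → d ≤ 10 * s + 10 → Full d
    full-all d 1≤d = walk d 1≤d
      where
      -- The upper bound is a premise inside `Q` because `interval` continues without end; past the
      -- last block the premise is contradictory.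
      Q : ℕ → Set
      Q d = d ≤ 10 * s + 10 → Full d
      block : ∀ {a w} → (∀ k → k < w → Full (a + k)) → ∀ k → k < w → Q (a + k)
      block f k k<w _ = f k k<w
      e₀ : ∀ s → 1 + 2 * s ≡ 2 * s + 1
      e₀ = solve-∀
      e₁ : ∀ s → 2 * s + 1 + s ≡ 2 * s + 1 + (s + 0)
      e₁ = solve-∀
      e₂ : ∀ s → 2 * s + 1 + (s + 0) + s ≡ 4 * s + 1
      e₂ = solve-∀
      e₃ : ∀ s → 4 * s + 1 + s ≡ 4 * s + 1 + (s + 0)
      e₃ = solve-∀
      e₄ : ∀ s → 4 * s + 1 + (s + 0) + s ≡ 6 * s + 1
      e₄ = solve-∀
      e₅ : ∀ s → 6 * s + 1 + s ≡ 7 * s + 1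
      e₅ = solve-∀
      e₆ : ∀ s → 7 * s + 1 + 1 ≡ 6 * s + 1 + (s + 1)
      e₆ = solve-∀
      e₇ : ∀ s → 6 * s + 1 + (s + 1) + s ≡ 8 * s + 2
      e₇ = solve-∀
      e₈ : ∀ s → 8 * s + 2 + s ≡ 9 * s + 2
      e₈ = solve-∀
      e₉ : ∀ s → 9 * s + 2 + 1 ≡ 8 * s + 2 + (s + 1)
      e₉ = solve-∀
      e₁₀ : ∀ s → 8 * s + 2 + (s + 1) + s ≡ 10 * s + 3
      e₁₀ = solve-∀
      e₁₁ : ∀ s → 10 * s + 3 + 8 ≡ 10 * s + 11
      e₁₁ = solve-∀
      walk : ∀ d → 1 ≤ d → Q d
      walk =
        interval {Q} 1 (2 * s) (block full-short) (e₀ s)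
        (interval {Q} (2 * s + 1) s (block (full-low 0 (2 * s + 1) (odd₁⊆bases s) full-odd)) (e₁ s)
        (interval {Q} (2 * s + 1 + (s + 0)) s (block (full-high 0 (2 * s + 1) (odd₁⊆bases s) full-odd)) (e₂ s)
        (interval {Q} (4 * s + 1) s (block (full-low 0 (4 * s + 1) (odd₂⊆bases s) full-odd)) (e₃ s)
        (interval {Q} (4 * s + 1 + (s + 0)) s (block (full-high 0 (4 * s + 1) (odd₂⊆bases s) full-odd)) (e₄ s)
        (interval {Q} (6 * s + 1) s (block (full-low 1 (6 * s + 1) (even₁⊆bases s) full-even)) (e₅ s)
        (interval {Q} (7 * s + 1) 1 (block (full-singleton (7 * s + 1) (there (there (there (here refl)))))) (e₆ s)
        (interval {Q} (6 * s + 1 + (s + 1)) s (block (full-high 1 (6 * s + 1) (even₁⊆bases s) full-even)) (e₇ s)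
        (interval {Q} (8 * s + 2) s (block (full-low 1 (8 * s + 2) (even₂⊆bases s) full-even)) (e₈ s)
        (interval {Q} (9 * s + 2) 1 (block (full-singleton (9 * s + 2) (there (there (there (there (here refl))))))) (e₉ s)
        (interval {Q} (8 * s + 2 + (s + 1)) s (block (full-high 1 (8 * s + 2) (even₂⊆bases s) full-even)) (e₁₀ s)
        (interval {Q} (10 * s + 3) 8 (block full-long) (e₁₁ s)
        (λ d d≥ d≤ → contradiction d≤ (<⇒≱ (≤-trans (≤-reflexive (sym (+-suc (10 * s) 10))) d≥))))))))))))))

    P-toℕ : ∀ {a : Fin n} → a ∈ T → P (toℕ a)
    P-toℕ {a} = subst (_∈ T) (sym (point-toℕ a))

    -- One of the two cyclic distances d and n − d between a and b is at most n / 2 ≤ 10 s + 10.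
    full-ordered : ∀ {a b : Fin n} → toℕ a < toℕ b → a ∈ T → b ∈ T → ∀ m → P m
    full-ordered {a} {b} a<b a∈T b∈T with toℕ b ∸ toℕ a ≤? 10 * s + 10
    ... | yes d≤ = full-all _ (m<n⇒0<n∸m a<b) d≤
            (toℕ a , P-toℕ a∈T , subst P (sym (m+[n∸m]≡n (<⇒≤ a<b))) (P-toℕ b∈T))
    ... | no d≰ = full-all (n ∸ d) (m<n⇒0<n∸m d<n) n∸d≤ (toℕ b , P-toℕ b∈T , subst P a+n≡ Pa+n)
      where
      d = toℕ b ∸ toℕ a
      a+d≡b : toℕ a + d ≡ toℕ b
      a+d≡b = m+[n∸m]≡n (<⇒≤ a<b)
      d<n : d < n
      d<n = ≤-<-trans (m∸n≤m (toℕ b) (toℕ a)) (toℕ<n b)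
      shuffle : ∀ s → 20 * s + 19 ≡ suc (10 * s + 10) + (10 * s + 8)
      shuffle = solve-∀
      n∸d≤ : n ∸ d ≤ 10 * s + 10
      n∸d≤ = ≤-trans (m≤n+o⇒m∸n≤o n d (≤-trans (≤-trans large (≤-reflexive (shuffle s)))
               (+-monoˡ-≤ (10 * s + 8) (≰⇒> d≰)))) (+-monoʳ-≤ (10 * s) (m≤n+m 8 2))
      a+n≡ : toℕ a + 1 * n ≡ toℕ b + (n ∸ d)
      a+n≡ = begin
        toℕ a + 1 * n         ≡⟨ cong (toℕ a +_) (*-identityˡ n) ⟩
        toℕ a + n             ≡⟨ cong (toℕ a +_) (m+[n∸m]≡n (<⇒≤ d<n)) ⟨
        toℕ a + (d + (n ∸ d)) ≡⟨ +-assoc (toℕ a) d (n ∸ d) ⟨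
        toℕ a + d + (n ∸ d)   ≡⟨ cong (_+ (n ∸ d)) a+d≡b ⟩
        toℕ b + (n ∸ d)       ∎
        where open ≡-Reasoning
      Pa+n : P (toℕ a + 1 * n)
      Pa+n = P-+* 1 (P-toℕ a∈T)

    full : ∀ {a b : Fin n} → a ≢ b → a ∈ T → b ∈ T → ∀ x → x ∈ T
    full {a} {b} a≢b a∈T b∈T x = subst (_∈ T) (point-toℕ x) (all-P (toℕ x))
      where
      all-P : ∀ m → P m
      all-P with <-cmp (toℕ a) (toℕ b)
      ... | tri< a<b _ _ = full-ordered a<b a∈T b∈T
      ... | tri≈ _ a≡b _ = contradiction (toℕ-injective a≡b) a≢b
      ... | tri> _ _ b<a = full-ordered b<a b∈T a∈T

  -- A closed `T` containing the two points of `p - v` contains every point, in particular `v`.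
  -- Conversely, the members of `D` are circuits, so their clauses are among those of all circuits.
  D-cover : IsCover n D
  D-cover = deduplicate-! _≟ˢ_ _ , D-circuits , λ T → mk⇔ (saturated T)
    (λ Φ-all p p∈D → Φ-all p (All.lookup D-circuits p∈D))
    where
    saturated : ∀ T → Φ (member D) T → Φ Circuit T
    saturated T closed p ∣p∣≡3 v v∈p = clause-intro λ p-v⊆T →
      let a , b , a≢b , a∈ , b∈ = twoElements ∣p∣≡3 v∈p in
      Saturation.full closed a≢b (p-v⊆T a∈) (p-v⊆T b∈) v

  length-D : length D ≤ (4 * s + 13) * n
  length-D = ≤-trans (length-orbits (bases s)) (≤-reflexive (cong (_* n) (length-bases s)))

-- Both bounds with an explicit constant.

theorem22 : Σ ℕ λ K → (n : ℕ) → 46 ≤ n →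
    Σ ℕ λ m → IsMinCoverSize n m × ((5 * m ≤ n * n + K * n) × (n * n ≤ 5 * m + K * n))
-- The constant is `5 * 13`, from the thirteen extra orbits; the loss of `n` in the lower bound is
-- absorbed.
theorem22 = 65 , bounds
  where
  bounds : (n : ℕ) → 46 ≤ n →
    Σ ℕ λ m → IsMinCoverSize n m × ((5 * m ≤ n * n + 65 * n) × (n * n ≤ 5 * m + 65 * n))
  bounds n 46≤n = m , min , upper , lower (proj₁ min)
    where
    instance
      n≢0 : NonZero n
      n≢0 = >-nonZero (≤-trans (s≤s z≤n) 46≤n)
    s = n / 20
    s*20≤n : s * 20 ≤ n
    s*20≤n = m/n*n≤m n 20
    n≤20s+19 : n ≤ 20 * s + 19
    n≤20s+19 = begin
      n                ≡⟨ m≡m%n+[m/n]*n n 20 ⟩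
      n % 20 + s * 20  ≤⟨ +-monoˡ-≤ (s * 20) (s≤s⁻¹ (m%n<n n 20)) ⟩
      19 + s * 20      ≡⟨ trans (+-comm 19 (s * 20)) (cong (_+ 19) (*-comm s 20)) ⟩
      20 * s + 19      ∎
      where open ≤-Reasoning
    -- Follows from `40 ≤ n ≤ 20 * s + 19`; the value two is what `10 * s + 11 < 20 * s` requires.
    2≤s : 2 ≤ s
    2≤s = *-cancelʳ-< 20 1 s (+-cancelʳ-≤ 19 21 (s * 20) (≤-trans (≤-trans (m≤n+m 40 6) 46≤n)
            (≤-trans n≤20s+19 (≤-reflexive (cong (_+ 19) (*-comm 20 s))))))
    10s+11<n : 10 * s + 11 < n
    10s+11<n = ≤-trans (begin-strict
      10 * s + 11      <⟨ +-monoʳ-< (10 * s) {11} {20} (m≤n+m 12 8) ⟩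
      10 * s + 20      ≤⟨ +-monoʳ-≤ (10 * s) (*-monoʳ-≤ 10 2≤s) ⟩
      10 * s + 10 * s  ≡⟨ shuffle s ⟩
      s * 20           ∎) s*20≤n
      where
      open ≤-Reasoning
      shuffle : ∀ s → 10 * s + 10 * s ≡ s * 20
      shuffle = solve-∀
    open Construction s (≤-trans (s≤s z≤n) 2≤s) 10s+11<n n≤20s+19
    m : ℕ
    m = proj₁ (minCoverSize D D-cover)
    min : IsMinCoverSize n m
    min = proj₂ (minCoverSize D D-cover)
    upper : 5 * m ≤ n * n + 65 * n
    upper = begin
      5 * m                     ≤⟨ *-monoʳ-≤ 5 (≤-trans (proj₂ min D D-cover) length-D) ⟩
      5 * ((4 * s + 13) * n)    ≡⟨ shuffle s n ⟩
      s * 20 * n + 65 * n       ≤⟨ +-monoˡ-≤ (65 * n) (*-monoˡ-≤ n s*20≤n) ⟩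
      n * n + 65 * n            ∎
      where
      open ≤-Reasoning
      shuffle : ∀ s n → 5 * ((4 * s + 13) * n) ≡ s * 20 * n + 65 * n
      shuffle = solve-∀
    lower : Σ (List (Subset n)) (λ E → IsCover n E × length E ≡ m) → n * n ≤ 5 * m + 65 * n
    lower (E , cover , ∣E∣≡m) = ≤-trans
      (LowerBound.n²≤5N+n E cover (≤-trans (m≤n+m 4 42) 46≤n))
      (+-mono-≤ (*-monoʳ-≤ 5 (≤-reflexive ∣E∣≡m)) (m≤n*m n 65))
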